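{- Let $\mathbb K$ be a field of characteristic $p>2$, $\Lambda_1,\dots,\Lambda_n\in\mathbb F_p^\times\subset\mathbb K$, $a\in\mathbb K\setminus\mathbb F_p$, and let $x^0\in\mathbb K^n$ be such that all $2np$ linear polynomials $s-x_i^0+\Lambda_i+aj$, $s-x_i^0+aj$ ($i=1,\dots,n$, $j=0,\dots,p-1$) in $s$ are pairwise distinct. Put $y_i^0=x_i^0-\Lambda_i$ and let $s_i(\varepsilon)\in\mathbb K[[\varepsilon]]$ be the formal branches defined in the context. Then for each $i=1,\dots,n$ the pullback $J(s_i(\varepsilon),x^0)$ is regular at $\varepsilon=0$ (its coordinates lie in $\mathbb K[[\varepsilon]]$), and $$J(s_i(\varepsilon),x^0)=W(y_i^0,x^0)+\mathcal O(\varepsilon).$$ The vectors $W(y_i^0,x^0)$, $i=1,\dots,n$, form a basis of $V_{\mathbb K}$.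
   Context: $\mathbb F_p$ is the prime subfield of $\mathbb K$, $n\ge1$. $V_{\mathbb K}$ is an $n$-dimensional $\mathbb K$-vector space with basis $f^{(1)},\dots,f^{(n)}$ (in the paper, a weight subspace of a tensor product of Verma modules). $W(s,x)=\sum_{j=1}^nW_j(s,x)f^{(j)}$ with $W_j(s,x)=\prod_{l<j}(s-x_l+\Lambda_l)\prod_{l>j}(s-x_l)$. With $\kappa=\varepsilon^{ -1}$, $$\Phi(s,x)=\kappa\prod_{l=1}^n\frac{s-x_l+\Lambda_l}{s-x_l+a},\qquad J(s,x)=\sum_{d=0}^{p-1}W(s+da,x)\prod_{j=0}^{d-1}\Phi(s+aj,x).$$ $s_i(\varepsilon)\in\mathbb K[[\varepsilon]]$ is the unique formal power series with $s_i(0)=y_i^0$ satisfying $$\prod_{l=1}^n\prod_{j=0}^{p-1}(s-x_l^0+\Lambda_l+aj)=\varepsilon^p\prod_{l=1}^n\prod_{j=0}^{p-1}(s-x_l^0+aj)$$ at $s=s_i(\varepsilon)$. $\mathcal O(\varepsilon)$ denotes a vector with coordinates in $\varepsilon\mathbb K[[\varepsilon]]$. -}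

module Defs where

open import Level using (Level; _⊔_)
open import Data.Bool.Base using (if_then_else_)
open import Data.Nat.Base as ℕ using (ℕ; zero; suc; _∸_)
open import Data.Nat.Divisibility using () renaming (_∣_ to _∣ℕ_)
open import Data.Fin.Base using (Fin; Fin′; toℕ)
open import Data.Fin.Properties using (_<?_)
open import Data.Product.Base using (_×_; _,_; ∃; proj₁)
open import Data.Sum.Base using (_⊎_; inj₁; inj₂)
open import Data.Vec.Functional using (Vector)
open import Function.Base using (_∘_)
open import Function.Bundles using (_⇔_)
open import Relation.Nullary.Decidable using (Dec; does)
open import Relation.Binary.PropositionalEquality using (_≢_)
open import Algebra.Bundles using (CommutativeRing; RawRing)
open import Algebra.Apartness.Bundles using (HeytingField)
open import Algebra.Module.Bundles using (Module)
import Algebra.Definitions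
import Algebra.Definitions.RawMonoid
import Algebra.Definitions.RawSemiring

-- The formulas for W, Φ, J and for the equation of the branches, over an
-- arbitrary coefficient ring R: they are used with R = 𝕂, 𝕂[[ε]] and 𝕂((ε)).

module Formulas {r ℓ} (R : RawRing r ℓ) {n : ℕ}
                (Λ x : Vector (RawRing.Carrier R) n) (a : RawRing.Carrier R) where

  open RawRing R
  open Algebra.Definitions _≈_ using (Invertible)
  open Algebra.Definitions.RawSemiring rawSemiring
    using (sum; product) renaming (_×_ to _×ₙ_)

  infixl 6 _-_
  _-_ : Carrier → Carrier → Carrier
  u - v = u + - v

  ∏-over : ∀ {q} {P : Fin n → Set q} → (∀ l → Dec (P l)) → Vector Carrier n → Carrier
  ∏-over P? t = product λ l → if does (P? l) then t l else 1#

  W : Carrier → Vector Carrier n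
  W s j = ∏-over (_<? j) (λ l → s - x l + Λ l) * ∏-over (j <?_) (λ l → s - x l)

  -- The two products over l and over 0 ≤ j < p in the equation of the branches.
  P Q : ℕ → Carrier → Carrier
  P p s = product λ (l : Fin n) → product λ (j : Fin p) → s - x l + Λ l + toℕ j ×ₙ a
  Q p s = product λ (l : Fin n) → product λ (j : Fin p) → s - x l + toℕ j ×ₙ a

  -- Φ(s,x) makes sense when its denominators are invertible in R.  Inverses
  -- are unique up to _≈_, so the value of Φ does not depend on the evidence.
  ΦDefined : Carrier → Set (r ⊔ ℓ)
  ΦDefined s = ∀ l → Invertible 1# _*_ (s - x l + a)

  Φ : Carrier → (s : Carrier) → ΦDefined s → Carrier
  Φ κ s inv = κ * product λ l → (s - x l + Λ l) * proj₁ (inv l)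

  -- Fin′ d is the range 0 ≤ j < d.
  JDefined : ℕ → Carrier → Set (r ⊔ ℓ)
  JDefined p s = ∀ (d : Fin p) (j : Fin′ d) → ΦDefined (s + toℕ j ×ₙ a)

  -- J κ p s inv is the vector of coordinates of J(s,x).
  J : Carrier → (p : ℕ) (s : Carrier) → JDefined p s → Vector Carrier n
  J κ p s inv i = sum λ (d : Fin p) →
    W (s + toℕ d ×ₙ a) i * product λ (j : Fin′ d) → Φ κ (s + toℕ j ×ₙ a) (inv d j)

module Series {r ℓ} (R : RawRing r ℓ) where

  open RawRing R
  open Algebra.Definitions.RawSemiring rawSemiring using (sum)

  -- A formal power series is its sequence of coefficients.
  PowerSeries : Set r
  PowerSeries = ℕ → Carrier

  constant : Carrier → PowerSeries
  constant u zero    = u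
  constant u (suc _) = 0#

  ε : PowerSeries
  ε 1 = 1#
  ε _ = 0#

  powerSeries : RawRing r ℓ
  powerSeries = record
    { Carrier = PowerSeries
    ; _≈_     = λ f g → ∀ k → f k ≈ g k
    ; _+_     = λ f g k → f k + g k
    ; _*_     = λ f g k → sum λ (i : Fin (suc k)) → f (toℕ i) * g (k ∸ toℕ i)
    ; -_      = λ f k → - f k
    ; 0#      = constant 0#
    ; 1#      = constant 1#
    }

  module PS where
    open RawRing powerSeries public using (_≈_; _+_; _*_; -_; 0#; 1#)
    open Algebra.Definitions.RawSemiring (RawRing.rawSemiring powerSeries) public using (_^_)

  -- R((ε)) is R[[ε]] localised at ε: the pair (N , f) stands for ε^(-N) f.
  -- Pairs are compared after multiplication by a common power of ε; this is
  -- sound since ε is not a zero divisor.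
  laurentSeries : RawRing r ℓ
  laurentSeries = record
    { Carrier = ℕ × PowerSeries
    ; _≈_     = λ (N , f) (M , g) → ε PS.^ M PS.* f PS.≈ ε PS.^ N PS.* g
    ; _+_     = λ (N , f) (M , g) → N ℕ.+ M , ε PS.^ M PS.* f PS.+ ε PS.^ N PS.* g
    ; _*_     = λ (N , f) (M , g) → N ℕ.+ M , f PS.* g
    ; -_      = λ (N , f) → N , PS.- f
    ; 0#      = 0 , PS.0#
    ; 1#      = 0 , PS.1#
    }

  LaurentSeries : Set r
  LaurentSeries = RawRing.Carrier laurentSeries

  fromPowerSeries : PowerSeries → LaurentSeries
  fromPowerSeries f = 0 , f

  ε⁻¹ : LaurentSeries
  ε⁻¹ = 1 , PS.1#

  Regular : LaurentSeries → Set (r ⊔ ℓ)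
  Regular u = ∃ λ f → RawRing._≈_ laurentSeries u (fromPowerSeries f)

  -- Membership in ε R[[ε]].
  DivisibleByε : PowerSeries → Set (r ⊔ ℓ)
  DivisibleByε f = ∃ λ g → f PS.≈ ε PS.* g

module LinearAlgebra {r ℓ m ℓm} {R : CommutativeRing r ℓ} (V : Module R m ℓm) where

  open CommutativeRing R using (Carrier; _≈_; 0#)
  open Module V
  open Algebra.Definitions.RawMonoid +ᴹ-rawMonoid using (sum)

  combination : ∀ {n} → Vector Carrier n → Vector Carrierᴹ n → Carrierᴹ
  combination c v = sum λ i → c i *ₗ v i

  record IsBasis {n} (v : Vector Carrierᴹ n) : Set (r ⊔ ℓ ⊔ m ⊔ ℓm) where
    field
      independent : ∀ c → combination c v ≈ᴹ 0ᴹ → ∀ i → c i ≈ 0#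
      spanning    : ∀ w → ∃ λ c → w ≈ᴹ combination c v

-- "Distinct" elements of the field are elements that are apart, as usual for
-- Heyting fields; a field with decidable equality is one with _≉_ as _#_.

module OverField {c ℓ₁ ℓ₂} (𝕂 : HeytingField c ℓ₁ ℓ₂) where

  open HeytingField 𝕂 using (Carrier; _≈_; _#_; _+_; _-_; -_; 0#; 1#; heytingCommutativeRing)
  open Algebra.Apartness.Bundles.HeytingCommutativeRing heytingCommutativeRing public
    using (commutativeRing)
  open CommutativeRing commutativeRing using (rawRing)
  open Algebra.Definitions.RawSemiring (RawRing.rawSemiring rawRing) using () renaming (_×_ to _×ₙ_)
  open Series rawRing public

  HasCharacteristic : ℕ → Set ℓ₁
  HasCharacteristic p = ∀ m → (m ×ₙ 1# ≈ 0#) ⇔ (p ∣ℕ m)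

  -- In positive characteristic the prime subfield is the set of multiples of 1.
  _∈𝔽ₚ : Carrier → Set ℓ₁
  u ∈𝔽ₚ = ∃ λ m → u ≈ m ×ₙ 1#

  _∈𝔽ₚˣ : Carrier → Set (ℓ₁ ⊔ ℓ₂)
  u ∈𝔽ₚˣ = u ∈𝔽ₚ × u # 0#

  _∉𝔽ₚ : Carrier → Set (c ⊔ ℓ₁ ⊔ ℓ₂)
  u ∉𝔽ₚ = ∀ v → v ∈𝔽ₚ → u # v

  -- (c₀ , c₁) is the polynomial c₀ + c₁ s.
  LinearPolynomial : Set c
  LinearPolynomial = Carrier × Carrier

  _#ₗ_ : LinearPolynomial → LinearPolynomial → Set ℓ₂
  (c₀ , c₁) #ₗ (d₀ , d₁) = c₀ # d₀ ⊎ c₁ # d₁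

  module Setup {n : ℕ} (p : ℕ) (Λ x⁰ : Vector Carrier n) (a : Carrier) where

    factor : (Fin n × Fin p) ⊎ (Fin n × Fin p) → LinearPolynomial
    factor (inj₁ (i , j)) = - x⁰ i + Λ i + toℕ j ×ₙ a , 1#
    factor (inj₂ (i , j)) = - x⁰ i + toℕ j ×ₙ a       , 1#

    FactorsDistinct : Set ℓ₂
    FactorsDistinct = ∀ u v → u ≢ v → factor u #ₗ factor v

    y⁰ : Vector Carrier n
    y⁰ i = x⁰ i - Λ i

    embed : Carrier → LaurentSeries
    embed = fromPowerSeries ∘ constant

    module F𝕂     = Formulas rawRing Λ x⁰ a
    module F𝕂⟦ε⟧  = Formulas powerSeries (constant ∘ Λ) (constant ∘ x⁰) (constant a)
    module F𝕂⦅ε⦆  = Formulas laurentSeries (embed ∘ Λ) (embed ∘ x⁰) (embed a)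

    record IsBranch (i : Fin n) (s : PowerSeries) : Set ℓ₁ where
      field
        initial  : s 0 ≈ y⁰ i
        equation : F𝕂⟦ε⟧.P p s PS.≈ ε PS.^ p PS.* F𝕂⟦ε⟧.Q p s

    PullbackDefined : PowerSeries → Set (c ⊔ ℓ₁)
    PullbackDefined s = F𝕂⦅ε⦆.JDefined p (fromPowerSeries s)

    pullback : (s : PowerSeries) → PullbackDefined s → Vector LaurentSeries n
    pullback s = F𝕂⦅ε⦆.J ε⁻¹ p (fromPowerSeries s)

    -- The vector u ∈ 𝕂((ε))ⁿ is equal to w + O(ε) with w ∈ 𝕂ⁿ.
    _≈_+O[ε] : Vector LaurentSeries n → Vector Carrier n → Set (c ⊔ ℓ₁)
    u ≈ w +O[ε] = ∀ j → ∃ λ r → DivisibleByε r × (u j ≈ₗ (embed (w j) +ₗ fromPowerSeries r))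
      where open RawRing laurentSeries using () renaming (_≈_ to _≈ₗ_; _+_ to _+ₗ_)

{-# OPTIONS --safe #-}

-- Since the linear factors are distinct, every factor of P at the branch
-- s = sᵢ(ε) other than s − xᵢ + Λᵢ is a unit of 𝕂[[ε]], so P(s) = ε^p Q(s)
-- forces ε^p ∣ s − xᵢ + Λᵢ.  This factor occurs in Φ(s), the first factor of
-- every term of J with 1 ≤ d ≤ p − 1; such a term therefore lies in
-- ε^(p−d) 𝕂[[ε]] ⊆ ε 𝕂[[ε]], and the term d = 0 is W(s) = W(yᵢ) + O(ε).
-- The vectors W(yᵢ) form a triangular matrix, with units on the diagonal,
-- because W_j(yᵢ) contains yᵢ − xᵢ + Λᵢ = 0 for j > i.

module Submission where

open import Level using (_⊔_)
open import Data.Bool.Base using (true; false; if_then_else_)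
open import Data.Nat.Base as ℕ using (ℕ; zero; suc; _∸_; _≤_; _<_; s≤s)
import Data.Nat.Properties as ℕ
open import Data.Fin.Base as Fin using (Fin; zero; suc; toℕ; fromℕ<)
open import Data.Fin.Properties using (_<?_; toℕ<n; toℕ-fromℕ<; <⇒≢; punchInᵢ≢i)
open import Data.Product.Base using (_×_; _,_; ∃; proj₁; proj₂; Σ-syntax)
open import Data.Sum.Base using (inj₁; inj₂)
open import Data.Sum.Properties using (inj₁-injective)
open import Data.Vec.Functional using (Vector; _∷_; removeAt)
open import Function.Base using (_∘_)
open import Relation.Binary.PropositionalEquality as ≡ using (_≡_; _≢_)
open import Relation.Nullary.Decidable using (Dec; does; yes; no)
open import Relation.Nullary.Negation using (contradiction)
open import Algebra.Apartness.Bundles using (HeytingField)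
open import Algebra.Bundles using (CommutativeRing; RawRing)
open import Algebra.Module.Bundles using (Module)
import Algebra.Definitions
import Algebra.Definitions.RawSemiring
import Algebra.Properties.AbelianGroup
import Algebra.Properties.CommutativeMonoid.Sum
import Algebra.Properties.CommutativeSemigroup
import Algebra.Properties.CommutativeSemigroup.Divisibility
import Algebra.Properties.Group
import Algebra.Properties.Ring
import Algebra.Properties.Semiring.Exp
import Algebra.Properties.Semiring.Sum
import Relation.Binary.Reasoning.Setoid
open import Defs

module PowerSeriesRing {r ℓ} (R : CommutativeRing r ℓ) where

  open CommutativeRing R
  open Series rawRing
  open Algebra.Properties.CommutativeSemigroup +-commutativeSemigroup
    using () renaming (interchange to +-interchange)
  open Algebra.Properties.AbelianGroup +-abelianGroup using (xyx⁻¹≈y)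
  open Relation.Binary.Reasoning.Setoid setoid

  -- Everything below rests on two recursions for the Cauchy product.  The
  -- first, (f * g)ₖ₊₁ = f₀ gₖ₊₁ + (f′ * g)ₖ with f′ = f ∘ suc, holds
  -- definitionally; this is the second.
  *-suc : ∀ f g k → (f PS.* g) (suc k) ≈ (f PS.* (g ∘ suc)) k + f (suc k) * g 0
  *-suc f g zero = begin
    f 0 * g 1 + (f 1 * g 0 + 0#)  ≈⟨ +-congˡ (+-identityʳ _) ⟩
    f 0 * g 1 + f 1 * g 0         ≈⟨ +-congʳ (+-identityʳ _) ⟨
    f 0 * g 1 + 0# + f 1 * g 0    ∎
  *-suc f g (suc k) = begin
    f 0 * g (2 ℕ.+ k) + ((f ∘ suc) PS.* g) (suc k)
      ≈⟨ +-congˡ (*-suc (f ∘ suc) g k) ⟩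
    f 0 * g (2 ℕ.+ k) + (((f ∘ suc) PS.* (g ∘ suc)) k + f (2 ℕ.+ k) * g 0)
      ≈⟨ +-assoc _ _ _ ⟨
    (f PS.* (g ∘ suc)) (suc k) + f (2 ℕ.+ k) * g 0
      ∎

  constant-0# : ∀ k → constant 0# k ≈ 0#
  constant-0# zero    = refl
  constant-0# (suc k) = refl

  ⋆-cong : ∀ {f f′ g g′} → f PS.≈ f′ → g PS.≈ g′ → f PS.* g PS.≈ f′ PS.* g′
  ⋆-cong p q zero    = +-congʳ (*-cong (p 0) (q 0))
  ⋆-cong p q (suc k) = +-cong (*-cong (p 0) (q (suc k))) (⋆-cong (p ∘ suc) q k)

  ⋆-comm : ∀ f g → f PS.* g PS.≈ g PS.* f
  ⋆-comm f g zero    = +-congʳ (*-comm (f 0) (g 0))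
  ⋆-comm f g (suc k) = begin
    f 0 * g (suc k) + ((f ∘ suc) PS.* g) k  ≈⟨ +-cong (*-comm _ _) (⋆-comm (f ∘ suc) g k) ⟩
    g (suc k) * f 0 + (g PS.* (f ∘ suc)) k  ≈⟨ +-comm _ _ ⟩
    (g PS.* (f ∘ suc)) k + g (suc k) * f 0  ≈⟨ *-suc g f k ⟨
    (g PS.* f) (suc k)                      ∎

  ⋆-distribʳ : ∀ h f g → (f PS.+ g) PS.* h PS.≈ f PS.* h PS.+ g PS.* h
  ⋆-distribʳ h f g zero = begin
    (f 0 + g 0) * h 0 + 0#              ≈⟨ +-cong (distribʳ _ _ _) (sym (+-identityʳ 0#)) ⟩
    (f 0 * h 0 + g 0 * h 0) + (0# + 0#) ≈⟨ +-interchange _ _ _ _ ⟩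
    (f 0 * h 0 + 0#) + (g 0 * h 0 + 0#) ∎
  ⋆-distribʳ h f g (suc k) = begin
    (f 0 + g 0) * h (suc k) + ((f ∘ suc PS.+ g ∘ suc) PS.* h) k
      ≈⟨ +-cong (distribʳ _ _ _) (⋆-distribʳ h (f ∘ suc) (g ∘ suc) k) ⟩
    (f 0 * h (suc k) + g 0 * h (suc k)) + (((f ∘ suc) PS.* h) k + ((g ∘ suc) PS.* h) k)
      ≈⟨ +-interchange _ _ _ _ ⟩
    (f PS.* h PS.+ g PS.* h) (suc k)
      ∎

  ⋆-scale : ∀ u f g k → ((λ i → u * f i) PS.* g) k ≈ u * (f PS.* g) k
  ⋆-scale u f g zero = begin
    u * f 0 * g 0 + 0#        ≈⟨ +-cong (*-assoc _ _ _) (sym (zeroʳ u)) ⟩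
    u * (f 0 * g 0) + u * 0#  ≈⟨ distribˡ _ _ _ ⟨
    u * (f 0 * g 0 + 0#)      ∎
  ⋆-scale u f g (suc k) = begin
    u * f 0 * g (suc k) + ((λ i → u * f (suc i)) PS.* g) k
      ≈⟨ +-cong (*-assoc _ _ _) (⋆-scale u (f ∘ suc) g k) ⟩
    u * (f 0 * g (suc k)) + u * ((f ∘ suc) PS.* g) k
      ≈⟨ distribˡ _ _ _ ⟨
    u * (f PS.* g) (suc k)
      ∎

  ⋆-assoc : ∀ f g h → (f PS.* g) PS.* h PS.≈ f PS.* (g PS.* h)
  ⋆-assoc f g h zero = +-congʳ (begin
    (f 0 * g 0 + 0#) * h 0  ≈⟨ *-congʳ (+-identityʳ _) ⟩
    f 0 * g 0 * h 0         ≈⟨ *-assoc _ _ _ ⟩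
    f 0 * (g 0 * h 0)       ≈⟨ *-congˡ (+-identityʳ _) ⟨
    f 0 * (g 0 * h 0 + 0#)  ∎)
  ⋆-assoc f g h (suc k) = begin
    (f 0 * g 0 + 0#) * h (suc k) + (((λ i → f 0 * g (suc i)) PS.+ (f ∘ suc) PS.* g) PS.* h) k
      ≈⟨ +-cong (trans (*-congʳ (+-identityʳ _)) (*-assoc _ _ _))
                (trans (⋆-distribʳ h (λ i → f 0 * g (suc i)) ((f ∘ suc) PS.* g) k) (+-cong (⋆-scale (f 0) (g ∘ suc) h k) (⋆-assoc (f ∘ suc) g h k))) ⟩
    f 0 * (g 0 * h (suc k)) + (f 0 * ((g ∘ suc) PS.* h) k + ((f ∘ suc) PS.* (g PS.* h)) k)
      ≈⟨ +-assoc _ _ _ ⟨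
    (f 0 * (g 0 * h (suc k)) + f 0 * ((g ∘ suc) PS.* h) k) + ((f ∘ suc) PS.* (g PS.* h)) k
      ≈⟨ +-congʳ (distribˡ _ _ _) ⟨
    (f PS.* (g PS.* h)) (suc k)
      ∎

  ⋆-zeroˡ : ∀ {z} → (∀ k → z k ≈ 0#) → ∀ f k → (z PS.* f) k ≈ 0#
  ⋆-zeroˡ z≈0 f zero    = trans (+-identityʳ _) (trans (*-congʳ (z≈0 0)) (zeroˡ _))
  ⋆-zeroˡ z≈0 f (suc k) =
    trans (+-cong (trans (*-congʳ (z≈0 0)) (zeroˡ _)) (⋆-zeroˡ (z≈0 ∘ suc) f k)) (+-identityʳ 0#)

  ⋆-identityˡ : ∀ f → PS.1# PS.* f PS.≈ f
  ⋆-identityˡ f zero    = trans (+-identityʳ _) (*-identityˡ _)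
  ⋆-identityˡ f (suc k) =
    trans (+-cong (*-identityˡ _) (⋆-zeroˡ (λ _ → refl) f k)) (+-identityʳ _)

  powerSeriesRing : CommutativeRing r ℓ
  powerSeriesRing = record
    { RawRing powerSeries
    ; isCommutativeRing = record
      { isRing = record
        { +-isAbelianGroup = record
          { isGroup = record
            { isMonoid = record
              { isSemigroup = record
                { isMagma = record
                  { isEquivalence = record
                    { refl  = λ k → refl
                    ; sym   = λ p k → sym (p k)
                    ; trans = λ p q k → trans (p k) (q k)
                    }
                  ; ∙-cong = λ p q k → +-cong (p k) (q k)
                  }
                ; assoc = λ f g h k → +-assoc (f k) (g k) (h k)
                }
              ; identity = (λ f k → trans (+-congʳ (constant-0# k)) (+-identityˡ (f k)))
                         , (λ f k → trans (+-congˡ (constant-0# k)) (+-identityʳ (f k)))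
              }
            ; inverse = (λ f k → trans (-‿inverseˡ (f k)) (sym (constant-0# k)))
                      , (λ f k → trans (-‿inverseʳ (f k)) (sym (constant-0# k)))
            ; ⁻¹-cong = λ p k → -‿cong (p k)
            }
          ; comm = λ f g k → +-comm (f k) (g k)
          }
        ; *-cong     = λ {f} {f′} {g} {g′} → ⋆-cong {f} {f′} {g} {g′}
        ; *-assoc    = ⋆-assoc
        ; *-identity = ⋆-identityˡ , (λ f k → trans (⋆-comm f PS.1# k) (⋆-identityˡ f k))
        ; distrib    = (λ f g h k → trans (⋆-comm f (g PS.+ h) k)
                                   (trans (⋆-distribʳ f g h k) (+-cong (⋆-comm g f k) (⋆-comm h f k))))
                     , ⋆-distribʳ
        }
      ; *-comm = ⋆-comm
      }
    }

  ε-shift : ∀ f k → (ε PS.* f) (suc k) ≈ f k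
  ε-shift f k = begin
    0# * f (suc k) + ((ε ∘ suc) PS.* f) k  ≈⟨ +-cong (zeroˡ _) (⋆-cong {g = f} ε∘suc≈1 (λ _ → refl) k) ⟩
    0# + (PS.1# PS.* f) k                  ≈⟨ +-identityˡ _ ⟩
    (PS.1# PS.* f) k                       ≈⟨ ⋆-identityˡ f k ⟩
    f k                                    ∎
    where
    ε∘suc≈1 : ε ∘ suc PS.≈ PS.1#
    ε∘suc≈1 zero    = refl
    ε∘suc≈1 (suc k) = refl

  ε-cancel : ∀ f g → ε PS.* f PS.≈ ε PS.* g → f PS.≈ g
  ε-cancel f g eq k = trans (sym (ε-shift f k)) (trans (eq (suc k)) (ε-shift g k))

  ≈constant+ε* : ∀ {u} f → f 0 ≈ u → f PS.≈ constant u PS.+ ε PS.* (f ∘ suc)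
  ≈constant+ε* {u} f f₀≈u zero = begin
    f 0                    ≈⟨ f₀≈u ⟩
    u                      ≈⟨ +-identityʳ u ⟨
    u + 0#                 ≈⟨ +-congˡ (trans (+-identityʳ _) (zeroˡ _)) ⟨
    u + (0# * f 1 + 0#)    ∎
  ≈constant+ε* f f₀≈u (suc k) = trans (sym (ε-shift (f ∘ suc) k)) (sym (+-identityˡ _))

  -- Long division of n by f, with u the inverse of the constant term of f.
  quotient : Carrier → PowerSeries → PowerSeries → PowerSeries
  quotient u f n zero    = u * n 0
  quotient u f n (suc k) = quotient u f (λ i → n (suc i) - u * n 0 * f (suc i)) k

  quotient-* : ∀ {u} f → u * f 0 ≈ 1# → ∀ n → quotient u f n PS.* f PS.≈ n
  quotient-* {u} f uf₀≈1 n zero = begin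
    u * n 0 * f 0 + 0#  ≈⟨ +-identityʳ _ ⟩
    u * n 0 * f 0       ≈⟨ *-congʳ (*-comm u (n 0)) ⟩
    n 0 * u * f 0       ≈⟨ *-assoc _ _ _ ⟩
    n 0 * (u * f 0)     ≈⟨ *-congˡ uf₀≈1 ⟩
    n 0 * 1#            ≈⟨ *-identityʳ _ ⟩
    n 0                 ∎
  quotient-* {u} f uf₀≈1 n (suc k) = begin
    v + (quotient u f (λ i → n (suc i) - u * n 0 * f (suc i)) PS.* f) k
      ≈⟨ +-congˡ (quotient-* f uf₀≈1 (λ i → n (suc i) - u * n 0 * f (suc i)) k) ⟩
    v + (n (suc k) - v)
      ≈⟨ +-assoc _ _ _ ⟨
    v + n (suc k) - v
      ≈⟨ xyx⁻¹≈y v (n (suc k)) ⟩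
    n (suc k)
      ∎
    where v = u * n 0 * f (suc k)

  invertible : ∀ {u} f → u * f 0 ≈ 1# → Algebra.Definitions.Invertible PS._≈_ PS.1# PS._*_ f
  invertible {u} f uf₀≈1 = g , gf≈1 , λ k → trans (⋆-comm f g k) (gf≈1 k)
    where
    g = quotient u f PS.1#
    gf≈1 = quotient-* f uf₀≈1 PS.1#

module RingCorrespondence
  {r₁ ℓ₁ r₂ ℓ₂ q} (R₁ : RawRing r₁ ℓ₁) (R₂ : RawRing r₂ ℓ₂)
  (_~_ : RawRing.Carrier R₁ → RawRing.Carrier R₂ → Set q)
  (0#-~ : RawRing.0# R₁ ~ RawRing.0# R₂)
  (1#-~ : RawRing.1# R₁ ~ RawRing.1# R₂)
  (+-~  : ∀ {u v f g} → u ~ f → v ~ g → RawRing._+_ R₁ u v ~ RawRing._+_ R₂ f g)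
  (*-~  : ∀ {u v f g} → u ~ f → v ~ g → RawRing._*_ R₁ u v ~ RawRing._*_ R₂ f g)
  (-‿~  : ∀ {u f} → u ~ f → RawRing.-_ R₁ u ~ RawRing.-_ R₂ f)
  where

  private
    module R₁ = RawRing R₁
    module R₂ = RawRing R₂
    module S₁ = Algebra.Definitions.RawSemiring R₁.rawSemiring
    module S₂ = Algebra.Definitions.RawSemiring R₂.rawSemiring

  sum-~ : ∀ {n} {f : Vector R₁.Carrier n} {g} → (∀ i → f i ~ g i) → S₁.sum f ~ S₂.sum g
  sum-~ {zero}  f~g = 0#-~
  sum-~ {suc n} f~g = +-~ (f~g zero) (sum-~ (f~g ∘ suc))

  product-~ : ∀ {n} {f : Vector R₁.Carrier n} {g} → (∀ i → f i ~ g i) → S₁.product f ~ S₂.product g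
  product-~ {zero}  f~g = 1#-~
  product-~ {suc n} f~g = *-~ (f~g zero) (product-~ (f~g ∘ suc))

  ×-~ : ∀ m {u f} → u ~ f → (m S₁.× u) ~ (m S₂.× f)
  ×-~ zero    u~f = 0#-~
  ×-~ (suc m) u~f = +-~ u~f (×-~ m u~f)

  if-~ : ∀ b {u v f g} → u ~ f → v ~ g → (if b then u else v) ~ (if b then f else g)
  if-~ true  u~f v~g = u~f
  if-~ false u~f v~g = v~g

  module _ {n} {Λ₁ x₁ : Vector R₁.Carrier n} {Λ₂ x₂ : Vector R₂.Carrier n}
           {a₁ : R₁.Carrier} {a₂ : R₂.Carrier}
           (Λ~ : ∀ l → Λ₁ l ~ Λ₂ l) (x~ : ∀ l → x₁ l ~ x₂ l) where

    private
      module F₁ = Formulas R₁ Λ₁ x₁ a₁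
      module F₂ = Formulas R₂ Λ₂ x₂ a₂

    ∏-over-~ : ∀ {q} {P : Fin n → Set q} (P? : ∀ l → Dec (P l)) {f g} →
               (∀ l → f l ~ g l) → F₁.∏-over P? f ~ F₂.∏-over P? g
    ∏-over-~ P? f~g = product-~ λ l → if-~ (does (P? l)) (f~g l) 1#-~

    W-~ : ∀ {s₁ s₂} → s₁ ~ s₂ → ∀ j → F₁.W s₁ j ~ F₂.W s₂ j
    W-~ s~ j = *-~ (∏-over-~ (_<? j) λ l → +-~ (+-~ s~ (-‿~ (x~ l))) (Λ~ l))
                   (∏-over-~ (j <?_) λ l → +-~ s~ (-‿~ (x~ l)))

module Products {r ℓ} (A : CommutativeRing r ℓ) where

  open CommutativeRing A hiding (zero)
  open Algebra.Definitions _≈_ using (Invertible)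
  open Algebra.Definitions.RawSemiring (RawRing.rawSemiring rawRing) using (product)
  open Algebra.Properties.CommutativeSemigroup *-commutativeSemigroup using (interchange)
  open Algebra.Properties.CommutativeSemigroup.Divisibility *-commutativeSemigroup
    using (_∣_; _,_; ∣-respʳ-≈; x∣ʳy⇒x∣ʳzy)
  open Algebra.Properties.CommutativeMonoid.Sum *-commutativeMonoid
    using () renaming (sum-remove to product-remove)
  open Relation.Binary.Reasoning.Setoid setoid

  Unit : Carrier → Set (r ⊔ ℓ)
  Unit = Invertible 1# _*_

  unit-resp-≈ : ∀ {u v} → u ≈ v → Unit u → Unit v
  unit-resp-≈ u≈v (u⁻¹ , u⁻¹u≈1 , uu⁻¹≈1) =
    u⁻¹ , trans (*-congˡ (sym u≈v)) u⁻¹u≈1 , trans (*-congʳ (sym u≈v)) uu⁻¹≈1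

  unit-1# : Unit 1#
  unit-1# = 1# , *-identityˡ 1# , *-identityˡ 1#

  unit-* : ∀ {u v} → Unit u → Unit v → Unit (u * v)
  unit-* (u⁻¹ , u⁻¹u≈1 , uu⁻¹≈1) (v⁻¹ , v⁻¹v≈1 , vv⁻¹≈1) = u⁻¹ * v⁻¹
    , trans (interchange _ _ _ _) (trans (*-cong u⁻¹u≈1 v⁻¹v≈1) (*-identityˡ 1#))
    , trans (interchange _ _ _ _) (trans (*-cong uu⁻¹≈1 vv⁻¹≈1) (*-identityˡ 1#))

  unit-product : ∀ {n} (f : Vector Carrier n) → (∀ i → Unit (f i)) → Unit (product f)
  unit-product {zero}  f f-unit = unit-1#
  unit-product {suc n} f f-unit = unit-* (f-unit zero) (unit-product (f ∘ suc) (f-unit ∘ suc))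

  x∣y⇒x∣yz : ∀ {q u} v → q ∣ u → q ∣ u * v
  x∣y⇒x∣yz v q∣u = ∣-respʳ-≈ (*-comm v _) (x∣ʳy⇒x∣ʳzy v q∣u)

  ∣-cancel-unit : ∀ {q u v} → Unit v → q ∣ u * v → q ∣ u
  ∣-cancel-unit {q} {u} {v} (v⁻¹ , _ , vv⁻¹≈1) q∣uv = ∣-respʳ-≈ eq (x∣ʳy⇒x∣ʳzy v⁻¹ q∣uv)
    where
    eq : v⁻¹ * (u * v) ≈ u
    eq = begin
      v⁻¹ * (u * v)  ≈⟨ *-comm _ _ ⟩
      u * v * v⁻¹    ≈⟨ *-assoc _ _ _ ⟩
      u * (v * v⁻¹)  ≈⟨ *-congˡ vv⁻¹≈1 ⟩
      u * 1#         ≈⟨ *-identityʳ u ⟩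
      u              ∎

  ∣product⇒∣factor : ∀ {n q} (f : Vector Carrier n) i → (∀ j → j ≢ i → Unit (f j)) →
                     q ∣ product f → q ∣ f i
  ∣product⇒∣factor {suc n} f i f-unit q∣∏f =
    ∣-cancel-unit (unit-product (removeAt f i) λ j → f-unit _ (punchInᵢ≢i i j))
                  (∣-respʳ-≈ (product-remove f) q∣∏f)

  ∣factor⇒∣product : ∀ {n q} (f : Vector Carrier n) i → q ∣ f i → q ∣ product f
  ∣factor⇒∣product {suc n} f i q∣fi =
    ∣-respʳ-≈ (sym (trans (product-remove f) (*-comm _ _))) (x∣ʳy⇒x∣ʳzy _ q∣fi)

  module _ {n} (Λ x : Vector Carrier n) (a : Carrier) where

    open Formulas rawRing Λ x a using (P)
    open Algebra.Definitions.RawSemiring (RawRing.rawSemiring rawRing) using () renaming (_×_ to _×ₙ_)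

    ∣P⇒∣factor : ∀ {q p s} i (j₀ : Fin p) → toℕ j₀ ≡ 0 →
      (∀ l j → (l , j) ≢ (i , j₀) → Unit (s - x l + Λ l + toℕ j ×ₙ a)) →
      q ∣ P p s → q ∣ s - x i + Λ i
    ∣P⇒∣factor {q} {p} {s} i j₀ j₀≡0 factor-unit q∣P =
      ∣-respʳ-≈ (trans (+-congˡ (reflexive (≡.cong (_×ₙ a) j₀≡0))) (+-identityʳ _))
        (∣product⇒∣factor (factor i) j₀ (λ j j≢j₀ → factor-unit i j (j≢j₀ ∘ ≡.cong proj₂))
          (∣product⇒∣factor (product ∘ factor) i
            (λ l l≢i → unit-product (factor l) λ j → factor-unit l j (l≢i ∘ ≡.cong proj₁)) q∣P))
      where
      factor : Fin n → Vector Carrier p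
      factor l j = s - x l + Λ l + toℕ j ×ₙ a

module Localisation {r ℓ} (A : CommutativeRing r ℓ) (t : CommutativeRing.Carrier A) where

  open CommutativeRing A hiding (zero)
  open Algebra.Definitions.RawSemiring (RawRing.rawSemiring rawRing)
    using (_^_; product; sum) renaming (_×_ to _×ₙ_)
  open Algebra.Properties.Semiring.Exp semiring using (^-homo-*; ^-congʳ)
  open Algebra.Properties.Semiring.Sum semiring using (*-distribˡ-sum)
  open Algebra.Properties.CommutativeSemigroup *-commutativeSemigroup using (x∙yz≈y∙xz; interchange)
  open Algebra.Properties.CommutativeSemigroup.Divisibility *-commutativeSemigroup
    using (_∣_; _,_; ∣-respʳ-≈; x∣ʳy⇒x∣ʳzy)
  open Algebra.Properties.Ring ring using (-‿distribʳ-*)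
  open Relation.Binary.Reasoning.Setoid setoid
  open Products A using (Unit; x∣y⇒x∣yz; ∣factor⇒∣product)

  -- For A = R[[ε]] and t = ε this is, definitionally, laurentSeries.
  localisation : RawRing r ℓ
  localisation = record
    { Carrier = ℕ × Carrier
    ; _≈_     = λ (N , f) (M , g) → t ^ M * f ≈ t ^ N * g
    ; _+_     = λ (N , f) (M , g) → N ℕ.+ M , t ^ M * f + t ^ N * g
    ; _*_     = λ (N , f) (M , g) → N ℕ.+ M , f * g
    ; -_      = λ (N , f) → N , - f
    ; 0#      = 0 , 0#
    ; 1#      = 0 , 1#
    }

  private module L = RawRing localisation
  open Algebra.Definitions.RawSemiring L.rawSemiring using () renaming (product to productL)

  embed : Carrier → L.Carrier
  embed f = 0 , f

  infix 4 _≃_/t^_ _≃_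
  record _≃_/t^_ (u : L.Carrier) (f : Carrier) (M : ℕ) : Set ℓ where
    constructor mk
    field equality : u L.≈ (M , f)
  open _≃_/t^_ public

  _≃_ : L.Carrier → Carrier → Set ℓ
  u ≃ f = u ≃ f /t^ 0

  ≃⇒≈ : ∀ {u f} → u ≃ f → proj₂ u ≈ t ^ proj₁ u * f
  ≃⇒≈ (mk eq) = trans (sym (*-identityˡ _)) eq

  ≈⇒≃ : ∀ {u f} → proj₂ u ≈ t ^ proj₁ u * f → u ≃ f
  ≈⇒≃ eq = mk (trans (*-identityˡ _) eq)

  ≃-refl : ∀ {M f} → (M , f) ≃ f /t^ M
  ≃-refl = mk refl

  embed-≃ : ∀ f → embed f ≃ f
  embed-≃ f = ≃-refl

  ≃-resp-≈ : ∀ {u f g M} → f ≈ g → u ≃ f /t^ M → u ≃ g /t^ M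
  ≃-resp-≈ f≈g (mk eq) = mk (trans eq (*-congˡ f≈g))

  ≃-+-embed : ∀ {u f g h} → f ≈ g + h → u ≃ f → u L.≈ embed g L.+ embed h
  ≃-+-embed f≈g+h u≃f =
    trans (equality u≃f) (*-congˡ (trans f≈g+h (sym (+-cong (*-identityˡ _) (*-identityˡ _)))))

  *-≃/ : ∀ {u v f g M N} → u ≃ f /t^ M → v ≃ g /t^ N → u L.* v ≃ f * g /t^ (M ℕ.+ N)
  *-≃/ {K , h} {L , k} {f} {g} {M} {N} (mk eq₁) (mk eq₂) = mk (begin
    t ^ (M ℕ.+ N) * (h * k)      ≈⟨ *-congʳ (^-homo-* t M N) ⟩
    t ^ M * t ^ N * (h * k)      ≈⟨ interchange _ _ _ _ ⟩
    (t ^ M * h) * (t ^ N * k)    ≈⟨ *-cong eq₁ eq₂ ⟩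
    (t ^ K * f) * (t ^ L * g)    ≈⟨ interchange _ _ _ _ ⟩
    t ^ K * t ^ L * (f * g)      ≈⟨ *-congʳ (^-homo-* t K L) ⟨
    t ^ (K ℕ.+ L) * (f * g)      ∎)

  +-≃ : ∀ {u v f g} → u ≃ f → v ≃ g → u L.+ v ≃ f + g
  +-≃ {K , h} {L , k} {f} {g} u≃f v≃g = ≈⇒≃ (begin
    t ^ L * h + t ^ K * k                      ≈⟨ +-cong (*-congˡ (≃⇒≈ u≃f)) (*-congˡ (≃⇒≈ v≃g)) ⟩
    t ^ L * (t ^ K * f) + t ^ K * (t ^ L * g)  ≈⟨ +-cong (x∙yz≈y∙xz _ _ _) refl ⟩
    t ^ K * (t ^ L * f) + t ^ K * (t ^ L * g)  ≈⟨ distribˡ _ _ _ ⟨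
    t ^ K * (t ^ L * f + t ^ L * g)            ≈⟨ *-congˡ (distribˡ _ _ _) ⟨
    t ^ K * (t ^ L * (f + g))                  ≈⟨ *-assoc _ _ _ ⟨
    t ^ K * t ^ L * (f + g)                    ≈⟨ *-congʳ (^-homo-* t K L) ⟨
    t ^ (K ℕ.+ L) * (f + g)                    ∎)

  -‿≃ : ∀ {u f} → u ≃ f → L.- u ≃ - f
  -‿≃ u≃f = ≈⇒≃ (trans (-‿cong (≃⇒≈ u≃f)) (-‿distribʳ-* _ _))

  product-≃/ : ∀ {n} {f : Vector L.Carrier n} {g} → (∀ i → f i ≃ g i /t^ 1) →
               productL f ≃ product g /t^ n
  product-≃/ {zero}  f≃g = ≃-refl
  product-≃/ {suc n} f≃g = *-≃/ (f≃g zero) (product-≃/ (f≃g ∘ suc))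

  open RingCorrespondence localisation rawRing _≃_ ≃-refl ≃-refl +-≃ *-≃/ -‿≃ public

  unit-≃ : ∀ {u f} → u ≃ f → Unit f → Algebra.Definitions.Invertible L._≈_ L.1# L._*_ u
  unit-≃ u≃f (f⁻¹ , f⁻¹f≈1 , ff⁻¹≈1) = embed f⁻¹
    , equality (≃-resp-≈ f⁻¹f≈1 (*-≃/ (≃-refl {0} {f⁻¹}) u≃f))
    , equality (≃-resp-≈ ff⁻¹≈1 (*-≃/ u≃f (≃-refl {0} {f⁻¹})))

  module _ (t-cancel : ∀ f g → t * f ≈ t * g → f ≈ g) where

    t^-cancel : ∀ d f g → t ^ d * f ≈ t ^ d * g → f ≈ g
    t^-cancel zero    f g eq = trans (sym (*-identityˡ f)) (trans eq (*-identityˡ g))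
    t^-cancel (suc d) f g eq = t^-cancel d f g
      (t-cancel _ _ (trans (sym (*-assoc _ _ _)) (trans eq (*-assoc _ _ _))))

    ≃-cancel : ∀ d {u f} → u ≃ t ^ d * f /t^ d → u ≃ f
    ≃-cancel d {K , h} {f} (mk eq) = ≈⇒≃ (t^-cancel d _ _ (trans eq (x∙yz≈y∙xz _ _ _)))

    module _ {n} (Λ x : Vector Carrier n) (a : Carrier) where

      private
        module F = Formulas rawRing Λ x a
        module G = Formulas localisation (embed ∘ Λ) (embed ∘ x) (embed a)
        open Algebra.Definitions.RawSemiring L.rawSemiring using () renaming (_×_ to _×L_)

      shift-≃ : ∀ s d → embed s L.+ d ×L embed a ≃ s + d ×ₙ a
      shift-≃ s d = +-≃ (embed-≃ s) (×-~ d (embed-≃ a))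

      J-defined : ∀ {p s} → F.JDefined p s → G.JDefined p (embed s)
      J-defined {s = s} inv d j l =
        unit-≃ (+-≃ (+-≃ (shift-≃ s (toℕ j)) (-‿≃ (embed-≃ (x l)))) (embed-≃ a)) (inv d j l)

      Φ-≃ : ∀ {p s} (inv : F.JDefined p s) d j →
            G.Φ (1 , 1#) (embed s L.+ toℕ j ×L embed a) (J-defined inv d j) ≃
              F.Φ 1# (s + toℕ j ×ₙ a) (inv d j) /t^ 1
      Φ-≃ {s = s} inv d j = *-≃/ ≃-refl (product-~ {n} λ l →
        *-≃/ (+-≃ (+-≃ (shift-≃ s (toℕ j)) (-‿≃ (embed-≃ (x l)))) (embed-≃ (Λ l)))
             (embed-≃ (proj₁ (inv d j l))))

      J-expansion : ∀ {p s} (inv : F.JDefined p s) → 0 < p → ∀ i → t ^ p ∣ s - x i + Λ i →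
                    ∀ k → ∃ λ g → G.J (1 , 1#) p (embed s) (J-defined inv) k ≃ F.W s k + t * g
      J-expansion {suc p} {s} inv _ i t^p∣ k =
        sum e , ≃-resp-≈ (+-congˡ (sym (*-distribˡ-sum t e))) (+-≃ first (sum-~ rest))
        where
        W-≃ : ∀ {u f} → u ≃ f → G.W u k ≃ F.W f k
        W-≃ u≃f = W-~ {a₁ = embed a} {a} (embed-≃ ∘ Λ) (embed-≃ ∘ x) u≃f k

        first : G.W (embed s L.+ 0 ×L embed a) k L.* L.1# ≃ F.W s k
        first = ≃-resp-≈ (*-identityʳ _) (*-≃/
          (W-≃ (≃-resp-≈ (+-identityʳ s) (shift-≃ s 0))) ≃-refl)

        φ : (d : Fin p) → Vector Carrier (suc (toℕ d))
        φ d j = F.Φ 1# (s + toℕ j ×ₙ a) (inv (suc d) j)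

        t^p∣∏φ : ∀ d → t ^ suc p ∣ product (φ d)
        t^p∣∏φ d = ∣factor⇒∣product (φ d) zero (x∣ʳy⇒x∣ʳzy 1# (∣factor⇒∣product
          (λ l → (s + 0# - x l + Λ l) * proj₁ (inv (suc d) zero l)) i (x∣y⇒x∣yz _ (∣-respʳ-≈ (+-congʳ (+-congʳ (sym (+-identityʳ s)))) t^p∣))))

        split-power : ∀ (d : Fin p) → t ^ suc p ≈ t ^ suc (toℕ d) * t ^ suc (p ∸ suc (toℕ d))
        split-power d = trans (^-congʳ t (≡.cong suc (≡.sym (≡.trans (ℕ.+-suc (toℕ d) _) (ℕ.m+[n∸m]≡n (toℕ<n d))))))
                              (^-homo-* t (suc (toℕ d)) (suc (p ∸ suc (toℕ d))))

        cofactor : Vector Carrier p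
        cofactor d = let (q , _) = t^p∣∏φ d in q * t ^ (p ∸ suc (toℕ d))

        ∏φ≈ : ∀ d → product (φ d) ≈ t ^ suc (toℕ d) * (t * cofactor d)
        ∏φ≈ d = let m = p ∸ suc (toℕ d); (q , qt^p≈∏φ) = t^p∣∏φ d in begin
          product (φ d)                  ≈⟨ qt^p≈∏φ ⟨
          q * t ^ suc p                        ≈⟨ *-congˡ (split-power d) ⟩
          q * (t ^ suc (toℕ d) * t ^ suc m)    ≈⟨ x∙yz≈y∙xz _ _ _ ⟩
          t ^ suc (toℕ d) * (q * (t * t ^ m))  ≈⟨ *-congˡ (x∙yz≈y∙xz _ _ _) ⟩
          t ^ suc (toℕ d) * (t * cofactor d)   ∎

        e : Vector Carrier p
        e d = F.W (s + suc (toℕ d) ×ₙ a) k * cofactor d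

        rest : ∀ d → G.W (embed s L.+ suc (toℕ d) ×L embed a) k L.*
               productL (λ j → G.Φ (1 , 1#) (embed s L.+ toℕ j ×L embed a) (J-defined inv (suc d) j)) ≃ t * e d
        rest d = ≃-resp-≈ (x∙yz≈y∙xz _ _ _)
          (*-≃/ (W-≃ (shift-≃ s (suc (toℕ d))))
                (≃-cancel (suc (toℕ d)) (≃-resp-≈ (∏φ≈ d) (product-≃/ (Φ-≃ inv (suc d))))))

module Triangular {r ℓ} (R : CommutativeRing r ℓ) where

  open CommutativeRing R hiding (zero)
  open Products R using (Unit)
  open Algebra.Definitions.RawSemiring (RawRing.rawSemiring rawRing) using (sum)
  open Algebra.Properties.CommutativeMonoid.Sum +-commutativeMonoid
    using (sum-cong-≋; sum-replicate-zero)
  open Relation.Binary.Reasoning.Setoid setoid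

  _·_ : ∀ {n} → Vector Carrier n → (Fin n → Vector Carrier n) → Vector Carrier n
  (c · M) j = sum λ i → c i * M i j

  record IsTriangular {n} (M : Fin n → Vector Carrier n) : Set (r ⊔ ℓ) where
    field
      upper    : ∀ {i j} → i Fin.< j → M i j ≈ 0#
      diagonal : ∀ i → Unit (M i i)

  minor : ∀ {n} → (Fin (suc n) → Vector Carrier (suc n)) → Fin n → Vector Carrier n
  minor M i j = M (suc i) (suc j)

  minor-triangular : ∀ {n} {M : Fin (suc n) → Vector Carrier (suc n)} →
                     IsTriangular M → IsTriangular (minor M)
  minor-triangular tri = record { upper = upper ∘ s≤s ; diagonal = diagonal ∘ suc }
    where open IsTriangular tri

  ·-minor : ∀ {n} {M : Fin (suc n) → Vector Carrier (suc n)} → IsTriangular M →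
            ∀ c j → (c · M) (suc j) ≈ ((c ∘ suc) · minor M) j
  ·-minor tri c j =
    trans (+-congʳ (trans (*-congˡ (IsTriangular.upper tri (s≤s ℕ.z≤n))) (zeroʳ _))) (+-identityˡ _)

  ·-surjective : ∀ {n} {M : Fin n → Vector Carrier n} → IsTriangular M →
                 (d : Vector Carrier n) → ∃ λ (c : Vector Carrier n) → ∀ j → (c · M) j ≈ d j
  ·-surjective {zero}      tri d = d , λ ()
  ·-surjective {suc n} {M} tri d = c , solves
    where
    tail-solution : ∃ λ (c′ : Vector Carrier n) → ∀ j → (c′ · minor M) j ≈ d (suc j)
    tail-solution = ·-surjective (minor-triangular tri) (d ∘ suc)

    c′ : Vector Carrier n
    c′ = proj₁ tail-solution

    M₀₀⁻¹ v : Carrier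
    M₀₀⁻¹ = proj₁ (IsTriangular.diagonal tri zero)
    v     = sum λ i → c′ i * M (suc i) zero

    c : Vector Carrier (suc n)
    c = (d zero - v) * M₀₀⁻¹ ∷ c′

    solves : ∀ j → (c · M) j ≈ d j
    solves zero    = begin
      (d zero - v) * M₀₀⁻¹ * M zero zero + v  ≈⟨ +-congʳ (*-assoc _ _ _) ⟩
      (d zero - v) * (M₀₀⁻¹ * M zero zero) + v
        ≈⟨ +-congʳ (*-congˡ (proj₁ (proj₂ (IsTriangular.diagonal tri zero)))) ⟩
      (d zero - v) * 1# + v                   ≈⟨ +-congʳ (*-identityʳ _) ⟩
      d zero - v + v                          ≈⟨ +-assoc _ _ _ ⟩
      d zero + (- v + v)                      ≈⟨ +-congˡ (-‿inverseˡ v) ⟩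
      d zero + 0#                             ≈⟨ +-identityʳ _ ⟩
      d zero                                  ∎
    solves (suc j) = trans (·-minor tri c j) (proj₂ tail-solution j)

  ·-injective : ∀ {n} {M : Fin n → Vector Carrier n} → IsTriangular M →
                (c : Vector Carrier n) → (∀ j → (c · M) j ≈ 0#) → ∀ i → c i ≈ 0#
  ·-injective {suc n} {M} tri c cM≈0 = c≈0
    where
    c′≈0 : ∀ i → c (suc i) ≈ 0#
    c′≈0 = ·-injective (minor-triangular tri) (c ∘ suc)
             (λ j → trans (sym (·-minor tri c j)) (cM≈0 (suc j)))

    c₀M₀₀≈0 : c zero * M zero zero ≈ 0#
    c₀M₀₀≈0 = begin
      c zero * M zero zero                                        ≈⟨ +-identityʳ _ ⟨
      c zero * M zero zero + 0#                                   ≈⟨ +-congˡ (sum-replicate-zero n) ⟨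
      c zero * M zero zero + sum {n} (λ _ → 0#)
        ≈⟨ +-congˡ (sum-cong-≋ {n} λ i → trans (*-congʳ (c′≈0 i)) (zeroˡ (M (suc i) zero))) ⟨
      (c · M) zero                                                ≈⟨ cM≈0 zero ⟩
      0#                                                          ∎

    c≈0 : ∀ i → c i ≈ 0#
    c≈0 zero    = let (M₀₀⁻¹ , _ , M₀₀M₀₀⁻¹≈1) = IsTriangular.diagonal tri zero in begin
      c zero                              ≈⟨ *-identityʳ _ ⟨
      c zero * 1#                         ≈⟨ *-congˡ M₀₀M₀₀⁻¹≈1 ⟨
      c zero * (M zero zero * M₀₀⁻¹)      ≈⟨ *-assoc _ _ _ ⟨
      c zero * M zero zero * M₀₀⁻¹        ≈⟨ *-congʳ c₀M₀₀≈0 ⟩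
      0# * M₀₀⁻¹                          ≈⟨ zeroˡ _ ⟩
      0#                                  ∎
    c≈0 (suc i) = c′≈0 i

module TriangularBasis {r ℓ m ℓm} {R : CommutativeRing r ℓ} (V : Module R m ℓm) where

  open CommutativeRing R hiding (zero)
  open Triangular R
  open Algebra.Definitions.RawSemiring (RawRing.rawSemiring rawRing) using (sum)
  open Module V
  open LinearAlgebra V
  open Relation.Binary.Reasoning.Setoid ≈ᴹ-setoid
  open Algebra.Properties.CommutativeMonoid.Sum +ᴹ-commutativeMonoid
    using (∑-comm) renaming (sum to sumᴹ; sum-cong-≋ to sumᴹ-cong)

  *ₗ-distribˡ-sum : ∀ {n} u (v : Vector Carrierᴹ n) → u *ₗ sumᴹ v ≈ᴹ sumᴹ (λ i → u *ₗ v i)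
  *ₗ-distribˡ-sum {zero}  u v = *ₗ-zeroʳ u
  *ₗ-distribˡ-sum {suc n} u v =
    ≈ᴹ-trans (*ₗ-distribˡ u _ _) (+ᴹ-congˡ (*ₗ-distribˡ-sum u (v ∘ suc)))

  *ₗ-distribʳ-sum : ∀ {n} (c : Vector Carrier n) v → sum c *ₗ v ≈ᴹ sumᴹ (λ i → c i *ₗ v)
  *ₗ-distribʳ-sum {zero}  c v = *ₗ-zeroˡ v
  *ₗ-distribʳ-sum {suc n} c v =
    ≈ᴹ-trans (*ₗ-distribʳ v _ _) (+ᴹ-congˡ (*ₗ-distribʳ-sum (c ∘ suc) v))

  combination-cong : ∀ {n} {c d : Vector Carrier n} → (∀ i → c i ≈ d i) →
                     ∀ v → combination c v ≈ᴹ combination d v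
  combination-cong c≈d v = sumᴹ-cong λ i → *ₗ-congʳ (c≈d i)

  combination-combination : ∀ {n} (c : Vector Carrier n) M v →
    combination c (λ i → combination (M i) v) ≈ᴹ combination (c · M) v
  combination-combination {n} c M v = begin
    sumᴹ (λ i → c i *ₗ sumᴹ (λ j → M i j *ₗ v j))
      ≈⟨ sumᴹ-cong {n} (λ i → *ₗ-distribˡ-sum (c i) λ j → M i j *ₗ v j) ⟩
    sumᴹ (λ i → sumᴹ (λ j → c i *ₗ (M i j *ₗ v j)))
      ≈⟨ sumᴹ-cong {n} (λ i → sumᴹ-cong {n} λ j → *ₗ-assoc (c i) (M i j) (v j)) ⟨
    sumᴹ (λ i → sumᴹ (λ j → (c i * M i j) *ₗ v j))
      ≈⟨ ∑-comm {n} {n} (λ i j → (c i * M i j) *ₗ v j) ⟩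
    sumᴹ (λ j → sumᴹ (λ i → (c i * M i j) *ₗ v j))
      ≈⟨ sumᴹ-cong {n} (λ j → *ₗ-distribʳ-sum (λ i → c i * M i j) (v j)) ⟨
    combination (c · M) v
      ∎

  triangular-basis : ∀ {n} {M : Fin n → Vector Carrier n} {v : Vector Carrierᴹ n} →
                     IsTriangular M → IsBasis v → IsBasis (λ i → combination (M i) v)
  triangular-basis {n} {M} {v} tri basis = record
    { independent = λ c cMv≈0 → ·-injective tri c
        (independent (c · M) (≈ᴹ-trans (≈ᴹ-sym (combination-combination c M v)) cMv≈0))
    ; spanning = λ w →
        let (d , w≈dv)  = spanning w
            (c , cM≈d) = ·-surjective tri d
        in c , ≈ᴹ-trans w≈dv (≈ᴹ-trans (combination-cong (λ j → sym (cM≈d j)) v)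
                                       (≈ᴹ-sym (combination-combination c M v)))
    }
    where open IsBasis basis

module Evaluation {r ℓ} (R : CommutativeRing r ℓ) where

  open CommutativeRing R
  open Series rawRing
  open PowerSeriesRing R

  infix 4 _at0≈_
  record _at0≈_ (f : PowerSeries) (u : Carrier) : Set ℓ where
    constructor mk
    field equality : f 0 ≈ u

  +-at0 : ∀ {f g u v} → f at0≈ u → g at0≈ v → f PS.+ g at0≈ u + v
  +-at0 (mk p) (mk q) = mk (+-cong p q)

  *-at0 : ∀ {f g u v} → f at0≈ u → g at0≈ v → f PS.* g at0≈ u * v
  *-at0 (mk p) (mk q) = mk (trans (+-identityʳ _) (*-cong p q))

  -‿at0 : ∀ {f u} → f at0≈ u → PS.- f at0≈ - u
  -‿at0 (mk p) = mk (-‿cong p)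

  constant-at0 : ∀ u → constant u at0≈ u
  constant-at0 u = mk refl

  open RingCorrespondence powerSeries rawRing _at0≈_
    (constant-at0 0#) (constant-at0 1#) +-at0 *-at0 -‿at0 public

  at0-+ε* : ∀ {f u} → f at0≈ u → ∀ g → f PS.+ ε PS.* g at0≈ u
  at0-+ε* (mk f₀≈u) g =
    mk (trans (+-cong f₀≈u (trans (+-identityʳ _) (zeroˡ (g 0)))) (+-identityʳ _))

  unit-at0 : ∀ {f u} → f at0≈ u → Products.Unit R u → Products.Unit powerSeriesRing f
  unit-at0 {f} (mk f₀≈u) (u⁻¹ , u⁻¹u≈1 , _) = invertible f (trans (*-congˡ f₀≈u) u⁻¹u≈1)

module Branches
  {c ℓ₁ ℓ₂} (𝕂 : HeytingField c ℓ₁ ℓ₂) {n p : ℕ} (0<p : 0 < p)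
  (Λ x⁰ : Vector (HeytingField.Carrier 𝕂) n) (a : HeytingField.Carrier 𝕂)
  (distinct : OverField.Setup.FactorsDistinct 𝕂 p Λ x⁰ a)
  where

  open HeytingField 𝕂 using (#⇒invertible; #-irrefl)
  open OverField 𝕂
  open Setup p Λ x⁰ a
  open CommutativeRing commutativeRing hiding (zero)
  open Algebra.Definitions.RawSemiring (RawRing.rawSemiring rawRing) using () renaming (_×_ to _×ₙ_)
  open Algebra.Properties.AbelianGroup +-abelianGroup using (xyx⁻¹≈y; ⁻¹-∙-comm)
  open Algebra.Properties.Group +-group using (⁻¹-involutive)
  open Algebra.Properties.CommutativeSemigroup +-commutativeSemigroup using (xy∙z≈xz∙y)
  open Products commutativeRing
  open Triangular commutativeRing
  open Relation.Binary.Reasoning.Setoid setoid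

  j₀ : Fin p
  j₀ = fromℕ< 0<p

  +j₀×a : ∀ u → u + toℕ j₀ ×ₙ a ≈ u
  +j₀×a u = trans (+-congˡ (reflexive (≡.cong (_×ₙ a) (toℕ-fromℕ< 0<p)))) (+-identityʳ u)

  y⁰-root : ∀ i → y⁰ i - x⁰ i + Λ i ≈ 0#
  y⁰-root i = trans (+-congʳ (xyx⁻¹≈y _ _)) (-‿inverseˡ _)

  factor-monic : ∀ u → proj₂ (factor u) ≈ 1#
  factor-monic (inj₁ _) = refl
  factor-monic (inj₂ _) = refl

  unit-at-y⁰ : ∀ i u → u ≢ inj₁ (i , j₀) → Unit (y⁰ i + proj₁ (factor u))
  unit-at-y⁰ i u u≢ with distinct u (inj₁ (i , j₀)) u≢
  ... | inj₂ 1#1 = contradiction 1#1 (#-irrefl (factor-monic u))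
  ... | inj₁ c#d = unit-resp-≈ (begin
    proj₁ (factor u) - (- x⁰ i + Λ i + toℕ j₀ ×ₙ a)  ≈⟨ +-congˡ (-‿cong (+j₀×a _)) ⟩
    proj₁ (factor u) - (- x⁰ i + Λ i)         ≈⟨ +-congˡ (⁻¹-∙-comm _ _) ⟨
    proj₁ (factor u) + (- - x⁰ i - Λ i)       ≈⟨ +-congˡ (+-congʳ (⁻¹-involutive _)) ⟩
    proj₁ (factor u) + y⁰ i                   ≈⟨ +-comm _ _ ⟩
    y⁰ i + proj₁ (factor u)                   ∎) (#⇒invertible c#d)

  unit-P : ∀ i l j → (l , j) ≢ (i , j₀) → Unit (y⁰ i - x⁰ l + Λ l + toℕ j ×ₙ a)
  unit-P i l j lj≢i0 = unit-resp-≈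
    (sym (trans (+-congʳ (+-assoc _ _ _)) (+-assoc _ _ _)))
    (unit-at-y⁰ i (inj₁ (l , j)) (lj≢i0 ∘ inj₁-injective))

  unit-Q : ∀ i l j → Unit (y⁰ i - x⁰ l + toℕ j ×ₙ a)
  unit-Q i l j = unit-resp-≈ (sym (+-assoc _ _ _)) (unit-at-y⁰ i (inj₂ (l , j)) λ ())

  unit-denominator : ∀ i l k → suc k < p → Unit (y⁰ i + k ×ₙ a - x⁰ l + a)
  unit-denominator i l k k<p = unit-resp-≈ (begin
    y⁰ i - x⁰ l + toℕ (fromℕ< k<p) ×ₙ a   ≡⟨ ≡.cong (λ m → y⁰ i - x⁰ l + m ×ₙ a) (toℕ-fromℕ< k<p) ⟩
    y⁰ i - x⁰ l + (a + k ×ₙ a)           ≈⟨ +-congˡ (+-comm _ _) ⟩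
    y⁰ i - x⁰ l + (k ×ₙ a + a)           ≈⟨ +-assoc _ _ _ ⟨
    y⁰ i - x⁰ l + k ×ₙ a + a             ≈⟨ +-congʳ (xy∙z≈xz∙y _ _ _) ⟩
    y⁰ i + k ×ₙ a - x⁰ l + a             ∎) (unit-Q i l (fromℕ< k<p))

  unit-if : ∀ {q} {P : Set q} (P? : Dec P) {u} → (P → Unit u) → Unit (if does P? then u else 1#)
  unit-if (yes p) P⇒unit = P⇒unit p
  unit-if (no ¬p) P⇒unit = unit-1#

  if-yes : ∀ {q} {P : Set q} (P? : Dec P) → P → ∀ {u : Carrier} → (if does P? then u else 1#) ≈ u
  if-yes (yes _) p = refl
  if-yes (no ¬p) p = contradiction p ¬p

  W-triangular : IsTriangular (λ i → F𝕂.W (y⁰ i))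
  W-triangular = record { upper = upper ; diagonal = diagonal }
    where
    open Algebra.Properties.CommutativeSemigroup.Divisibility *-commutativeSemigroup using (_,_)

    upper : ∀ {i j} → i Fin.< j → F𝕂.W (y⁰ i) j ≈ 0#
    upper {i} {j} i<j =
      let (q , q0≈∏) = ∣factor⇒∣product (λ l → if does (l <? j) then y⁰ i - x⁰ l + Λ l else 1#) i
                         (0# , trans (zeroˡ 0#) (sym (trans (if-yes (i <? j) i<j) (y⁰-root i))))
      in trans (*-congʳ (trans (sym q0≈∏) (zeroʳ q))) (zeroˡ _)

    diagonal : ∀ i → Unit (F𝕂.W (y⁰ i) i)
    diagonal i = unit-*
      (unit-product _ λ l → unit-if (l <? i) λ l<i →
        unit-resp-≈ (+j₀×a _) (unit-P i l j₀ (<⇒≢ l<i ∘ ≡.cong proj₁)))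
      (unit-product _ λ l → unit-if (i <? l) λ _ → unit-resp-≈ (+j₀×a _) (unit-Q i l j₀))

  open PowerSeriesRing commutativeRing using (powerSeriesRing; ε-cancel; ≈constant+ε*)
  open Evaluation commutativeRing
  open Localisation powerSeriesRing ε using (_≃_; mk; equality; ≃-+-embed; J-defined; J-expansion)
  private module A = CommutativeRing powerSeriesRing
  open Algebra.Properties.CommutativeSemigroup.Divisibility A.*-commutativeSemigroup using (_∣_; _,_)

  module _ {i s} (branch : IsBranch i s) where

    open IsBranch branch

    s-at0 : s at0≈ y⁰ i
    s-at0 = mk initial

    shift-at0 : ∀ l → s F𝕂⟦ε⟧.- constant (x⁰ l) at0≈ y⁰ i - x⁰ l
    shift-at0 l = +-at0 s-at0 (-‿at0 (constant-at0 (x⁰ l)))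

    ε^p∣factor : ε PS.^ p ∣ s F𝕂⟦ε⟧.- constant (x⁰ i) PS.+ constant (Λ i)
    ε^p∣factor = Products.∣P⇒∣factor powerSeriesRing (constant ∘ Λ) (constant ∘ x⁰) (constant a) i j₀ (toℕ-fromℕ< 0<p)
      (λ l j lj≢i0 → unit-at0
        (+-at0 (+-at0 (shift-at0 l) (constant-at0 (Λ l))) (×-~ (toℕ j) (constant-at0 a)))
        (unit-P i l j lj≢i0))
      (F𝕂⟦ε⟧.Q p s , A.trans {i = F𝕂⟦ε⟧.Q p s PS.* ε PS.^ p}
        (A.*-comm (F𝕂⟦ε⟧.Q p s) (ε PS.^ p)) (A.sym {x = F𝕂⟦ε⟧.P p s} equation))

    J-defined-PS : F𝕂⟦ε⟧.JDefined p s
    J-defined-PS d j l = unit-at0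
      (+-at0 (+-at0 (+-at0 s-at0 (×-~ (toℕ j) (constant-at0 a))) (-‿at0 (constant-at0 (x⁰ l)))) (constant-at0 a))
      (unit-denominator i l (toℕ j) (ℕ.≤-<-trans (toℕ<n j) (toℕ<n d)))

    pullback-defined : PullbackDefined s
    pullback-defined = J-defined ε-cancel (constant ∘ Λ) (constant ∘ x⁰) (constant a) J-defined-PS

    pullback-expansion : ∀ k → ∃ λ f → pullback s pullback-defined k ≃ f × f at0≈ F𝕂.W (y⁰ i) k
    pullback-expansion k =
      let (g , J≃f) = J-expansion ε-cancel (constant ∘ Λ) (constant ∘ x⁰) (constant a) J-defined-PS 0<p
                        i ε^p∣factor k
      in  F𝕂⟦ε⟧.W s k PS.+ ε PS.* g , J≃f , at0-+ε*
            (W-~ {a₁ = constant a} {a} (constant-at0 ∘ Λ) (constant-at0 ∘ x⁰) s-at0 k) g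

    pullback-regular : ∀ k → Regular (pullback s pullback-defined k)
    pullback-regular k = let (f , J≃f , _) = pullback-expansion k in f , equality J≃f

    pullback-leading : pullback s pullback-defined ≈ F𝕂.W (y⁰ i) +O[ε]
    pullback-leading k =
      let (f , J≃f , mk f₀≈w) = pullback-expansion k
          w = F𝕂.W (y⁰ i) k
          r = ε PS.* (f ∘ suc)
      in  r , (f ∘ suc , A.refl {r}) , ≃-+-embed {f = f} {constant w} {r} (≈constant+ε* f f₀≈w) J≃f

corollaryB4 :
    ∀ {c ℓ₁ ℓ₂ m ℓm} (𝕂 : HeytingField c ℓ₁ ℓ₂) →
    let open HeytingField 𝕂 using (Carrier)
        open OverField 𝕂 in
    (p n : ℕ) → HasCharacteristic p → 2 < p → 1 ≤ n →
    (V : Module commutativeRing m ℓm) →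
    let open Module V using (Carrierᴹ)
        open LinearAlgebra V in
    (f : Vector Carrierᴹ n) → IsBasis f →
    (Λ : Vector Carrier n) → (∀ i → Λ i ∈𝔽ₚˣ) →
    (a : Carrier) → a ∉𝔽ₚ →
    (x⁰ : Vector Carrier n) →
    let open Setup p Λ x⁰ a in
    FactorsDistinct →
    (∀ (i : Fin n) (s : PowerSeries) → IsBranch i s →
       Σ[ inv ∈ PullbackDefined s ]
         ((∀ j → Regular (pullback s inv j)) ×
          (pullback s inv ≈ F𝕂.W (y⁰ i) +O[ε])))
    × IsBasis (λ i → combination (F𝕂.W (y⁰ i)) f)
corollaryB4 𝕂 p n _ 2<p _ V f f-basis Λ _ a _ x⁰ distinct =
    (λ i s branch → pullback-defined branch , pullback-regular branch , pullback-leading branch)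
  , TriangularBasis.triangular-basis V W-triangular f-basis
  where open Branches 𝕂 (ℕ.<-trans ℕ.0<1+n 2<p) Λ x⁰ a distinct
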